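{- Let $L\geq 1$ be an integer. Let $\mathcal{U}$ be the set of all partitions with positive norm, and for $\pi\in\mathcal{U}$ let $s(\pi)$ and $l(\pi)$ denote its smallest and largest parts. Then, as formal power series in $q$, \[ \sum_{\substack{\pi\in\mathcal{U}\\ l(\pi)-s(\pi)\leq L}} (-1)^{s(\pi)+1}q^{|\pi|} \;=\; \sum_{s\geq 1}\frac{(-1)^{s+1}q^s}{(q^s;q)_{L+1}}, \] and this series has all coefficients non-negative.
   Context: $|\pi|$ denotes the sum of the parts of $\pi$. $(a;q)_n=\prod_{i=0}^{n-1}(1-aq^i)$. A series $\sum_{n\geq0}a_nq^n$ is non-negative if $a_n\geq 0$ for all $n$. -}

module Defs where

open import Data.Nat as ℕ using (ℕ; zero; suc; _⊔_; _⊓_; _∸_; _≥?_)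
open import Data.Integer as ℤ using (ℤ; -_; 0ℤ; 1ℤ)
open import Data.List using (List; []; _∷_; map; upTo; filter; concatMap; zipWith; foldr)
open import Data.Nat.ListAction using (sum)
open import Data.List.Relation.Unary.Linked using (Linked; linked?)
open import Relation.Nullary.Decidable using (_×-dec_; yes; no)
open import Relation.Binary.PropositionalEquality using (_≡_)

PS : Set
PS = ℕ → ℤ

sumℤ : List ℤ → ℤ
sumℤ = foldr ℤ._+_ 0ℤ

neg1^ : ℕ → ℤ
neg1^ zero    = 1ℤ
neg1^ (suc k) = - neg1^ k

1ₚ : PS
1ₚ zero    = 1ℤ
1ₚ (suc _) = 0ℤ

X^ : ℕ → PS
X^ m n with m ℕ.≟ n
... | yes _ = 1ℤ
... | no  _ = 0ℤ

_-ₚ_ : PS → PS → PS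
(f -ₚ g) n = f n ℤ.- g n

_*ₚ_ : PS → PS → PS
(f *ₚ g) n = sumℤ (map (λ k → f k ℤ.* g (n ∸ k)) (upTo (suc n)))

_·ₚ_ : ℤ → PS → PS
(c ·ₚ f) n = c ℤ.* f n

prodₚ : List PS → PS
prodₚ = foldr _*ₚ_ 1ₚ

qPoch : ℕ → ℕ → PS
qPoch s k = prodₚ (map (λ i → 1ₚ -ₚ X^ (s ℕ.+ i)) (upTo k))

-- Multiplicative inverse of a series f with constant term 1:
-- g_0 = 1, g_n = - Σ_{k=1}^{n} f_k g_{n-k}.
-- invRev f n = [g_n, g_{n-1}, ..., g_0]
invRev : PS → ℕ → List ℤ
invRev f zero    = 1ℤ ∷ []
invRev f (suc n) =
  let r = invRev f n in
  (- sumℤ (zipWith (λ j x → f (suc j) ℤ.* x) (upTo (suc n)) r)) ∷ r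

headOr0 : List ℤ → ℤ
headOr0 []      = 0ℤ
headOr0 (x ∷ _) = x

inv : PS → PS
inv f n = headOr0 (invRev f n)

-- Σ_{s ≥ 1} F s, for a family where F s has order ≥ s (so the coefficient
-- of q^n only receives contributions from 1 ≤ s ≤ n).
Σ≥1 : (ℕ → PS) → PS
Σ≥1 F n = sumℤ (map (λ s → F s n) (map suc (upTo n)))

rhs : ℕ → PS
rhs L = Σ≥1 (λ s → neg1^ (suc s) ·ₚ (X^ s *ₚ inv (qPoch s (suc L))))

lists : ℕ → ℕ → List (List ℕ)
lists zero    n = [] ∷ []
lists (suc k) n = concatMap (λ x → map (x ∷_) (lists k n)) (map suc (upTo n))

norm : List ℕ → ℕ
norm = sum

-- the partitions of n (a partition of n has at most n parts, each ≤ n)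
partitions : ℕ → List (List ℕ)
partitions n =
  filter (λ π → linked? _≥?_ π ×-dec (norm π ℕ.≟ n))
         (concatMap (λ k → lists k n) (upTo (suc n)))

largest : List ℕ → ℕ
largest = foldr _⊔_ 0

smallest : List ℕ → ℕ
smallest []           = 0
smallest (x ∷ [])     = x
smallest (x ∷ y ∷ ys) = x ⊓ smallest (y ∷ ys)

lhs : ℕ → PS
lhs L n =
  sumℤ (map (λ π → neg1^ (suc (smallest π)))
    (filter (λ π → ℕ._<?_ 0 (norm π) ×-dec ℕ._≤?_ (largest π ∸ smallest π) L)
      (partitions n)))

{-# OPTIONS --safe #-}
-- Write R s for the generating function q^s/(q^s;q)_{L+1} of the partitions with smallest part s
-- and largest part at most s + L.  Counting partitions with parts in [s, s + L] and subtracting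
-- those with parts in [s + 1, s + L] identifies both sides with Σ_s (−1)^{s+1} R s, so it is enough
-- that Σ_{s≥2} R s ≤ R 1 coefficientwise.  Let A = 1/(q²;q)_L and F = 1/(q;q)_{L+1} = A/(1 − q).
-- Since q^s(1 − q^L)/(q^s;q)_{L+1} = 1/(q^s;q)_L − 1/(q^{s+1};q)_L, the sum T = Σ_{s≥2} R s
-- satisfies (1 − q^L) T = A − 1, while removing a part from a nonempty partition gives
-- A − 1 ≤ (q² + ⋯ + q^{L+1}) A = q²(1 − q^L) F.  Induction on the exponent in steps of L yields
-- T ≤ q² F ≤ q F = R 1.
module Submission where

open import Defs
open import Data.Nat as ℕ using (ℕ; zero; suc; _≥_; _∸_; z≤n; s≤s)
import Data.Nat.Properties as ℕₚ
open import Data.Nat.Induction using (<-rec)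
open import Data.Integer as ℤ using (ℤ; 0ℤ; 1ℤ; -_; _+_; _-_; _*_; _≤_)
import Data.Integer.Properties as ℤₚ
open import Data.Integer.Tactic.RingSolver using (solve-∀)
open import Data.List using (List; []; _∷_; _++_; applyUpTo; upTo; map; zipWith; filter; concatMap)
open import Data.List.Properties using (map-∘)
open import Data.List.Relation.Unary.All as All using (All; []; _∷_; all?)
open import Data.List.Relation.Unary.AllPairs using (_∷_)
open import Data.List.Relation.Unary.Linked as Linked using (Linked; []; [-]; _∷_; linked?)
open import Data.List.Relation.Unary.Linked.Properties using (Linked⇒AllPairs)
open import Data.Product using (_×_; _,_)
open import Data.Sum using (_⊎_; inj₁; inj₂)
open import Function using (_∘_; id)
open import Relation.Binary.Definitions using (tri<; tri≈; tri>)
open import Relation.Nullary using (Dec; yes; no; ¬_; contradiction)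
open import Relation.Nullary.Decidable using (_×-dec_)
open import Relation.Unary using (Decidable)
open import Relation.Binary.PropositionalEquality

-- Finite sums of integers.

∑ : ℕ → (ℕ → ℤ) → ℤ
∑ zero    f = 0ℤ
∑ (suc n) f = f 0 + ∑ n (f ∘ suc)

∑-cong : ∀ n {f g} → (∀ k → k ℕ.< n → f k ≡ g k) → ∑ n f ≡ ∑ n g
∑-cong zero    eq = refl
∑-cong (suc n) eq = cong₂ _+_ (eq 0 (s≤s z≤n)) (∑-cong n λ k k<n → eq (suc k) (s≤s k<n))

∑-mono : ∀ n {f g} → (∀ k → f k ≤ g k) → ∑ n f ≤ ∑ n g
∑-mono zero    le = ℤₚ.≤-refl
∑-mono (suc n) le = ℤₚ.+-mono-≤ (le 0) (∑-mono n (le ∘ suc))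

∑-zero : ∀ n → ∑ n (λ _ → 0ℤ) ≡ 0ℤ
∑-zero zero    = refl
∑-zero (suc n) = trans (ℤₚ.+-identityˡ _) (∑-zero n)

∑-+ : ∀ n f g → ∑ n (λ k → f k + g k) ≡ ∑ n f + ∑ n g
∑-+ zero    f g = refl
∑-+ (suc n) f g = trans (cong (f 0 + g 0 +_) (∑-+ n (f ∘ suc) (g ∘ suc))) (interchange (f 0) (g 0) (∑ n (f ∘ suc)) (∑ n (g ∘ suc)))
  where
  interchange : ∀ a b c d → (a + b) + (c + d) ≡ (a + c) + (b + d)
  interchange = solve-∀

∑-neg : ∀ n f → ∑ n (λ k → - f k) ≡ - ∑ n f
∑-neg zero    f = refl
∑-neg (suc n) f = trans (cong (- f 0 +_) (∑-neg n (f ∘ suc))) (sym (ℤₚ.neg-distrib-+ (f 0) (∑ n (f ∘ suc))))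

∑-minus : ∀ n f g → ∑ n (λ k → f k - g k) ≡ ∑ n f - ∑ n g
∑-minus n f g = trans (∑-+ n f (λ k → - g k)) (cong (∑ n f +_) (∑-neg n g))

∑-last : ∀ n f → ∑ (suc n) f ≡ ∑ n f + f n
∑-last zero    f = ℤₚ.+-comm (f 0) 0ℤ
∑-last (suc n) f = trans (cong (f 0 +_) (∑-last n (f ∘ suc))) (sym (ℤₚ.+-assoc (f 0) (∑ n (f ∘ suc)) (f (suc n))))

∑-telescope : ∀ n (f : ℕ → ℤ) → ∑ n (λ k → f k - f (suc k)) ≡ f 0 - f n
∑-telescope zero    f = sym (ℤₚ.+-inverseʳ (f 0))
∑-telescope (suc n) f = trans (cong (f 0 - f 1 +_) (∑-telescope n (f ∘ suc))) (cancel (f 0) (f 1) (f (suc n)))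
  where
  cancel : ∀ a b c → (a - b) + (b - c) ≡ a - c
  cancel = solve-∀

sum-applyUpTo : ∀ (f : ℕ → ℤ) (g : ℕ → ℕ) n → sumℤ (map f (applyUpTo g n)) ≡ ∑ n (f ∘ g)
sum-applyUpTo f g zero    = refl
sum-applyUpTo f g (suc n) = cong (f (g 0) +_) (sum-applyUpTo f (g ∘ suc) n)

-- Multiplication by powers of q, as a shift of coefficients.

shift : ℕ → PS → PS
shift zero    f n       = f n
shift (suc a) f zero    = 0ℤ
shift (suc a) f (suc n) = shift a f n

-- The hypothesis is restricted to the exponents `m` that can reach `n`. For a positive shift these
-- are smaller than `n`, so an induction hypothesis of a strong induction on the exponent can be
-- passed in directly.
shift-rel : ∀ {ℓ} (_~_ : ℤ → ℤ → Set ℓ) → 0ℤ ~ 0ℤ → ∀ a {f g} n →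
            (∀ m → a ℕ.+ m ℕ.≤ n → f m ~ g m) → shift a f n ~ shift a g n
shift-rel _~_ z zero    n       r = r n ℕₚ.≤-refl
shift-rel _~_ z (suc a) zero    r = z
shift-rel _~_ z (suc a) (suc n) r = shift-rel _~_ z a n λ m le → r m (s≤s le)

shift-cong : ∀ a {f g} → f ≗ g → shift a f ≗ shift a g
shift-cong a eq n = shift-rel _≡_ refl a n λ m _ → eq m

shift-mono : ∀ a {f g} → (∀ m → f m ≤ g m) → ∀ n → shift a f n ≤ shift a g n
shift-mono a le n = shift-rel _≤_ ℤₚ.≤-refl a n λ m _ → le m

shift-zero : ∀ a n → shift a (λ _ → 0ℤ) n ≡ 0ℤ
shift-zero zero    n       = refl
shift-zero (suc a) zero    = refl
shift-zero (suc a) (suc n) = shift-zero a n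

shift-nonneg : ∀ a {f} → (∀ m → 0ℤ ≤ f m) → ∀ n → 0ℤ ≤ shift a f n
shift-nonneg a {f} nn n = subst (_≤ shift a f n) (shift-zero a n) (shift-mono a nn n)

shift-vanish : ∀ a f n → n ℕ.< a → shift a f n ≡ 0ℤ
shift-vanish (suc a) f zero    _         = refl
shift-vanish (suc a) f (suc n) (s≤s n<a) = shift-vanish a f n n<a

shift-≤ : ∀ a f n → a ℕ.≤ n → shift a f n ≡ f (n ∸ a)
shift-≤ zero    f n       _         = refl
shift-≤ (suc a) f (suc n) (s≤s a≤n) = shift-≤ a f n a≤n

shift-shift : ∀ a b f → shift a (shift b f) ≗ shift (a ℕ.+ b) f
shift-shift zero    b f n       = refl
shift-shift (suc a) b f zero    = refl
shift-shift (suc a) b f (suc n) = shift-shift a b f n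

shift-minus : ∀ a f g n → shift a (f -ₚ g) n ≡ shift a f n - shift a g n
shift-minus zero    f g n       = refl
shift-minus (suc a) f g zero    = refl
shift-minus (suc a) f g (suc n) = shift-minus a f g n

shift-∑ : ∀ a N (f : ℕ → PS) n → shift a (λ m → ∑ N (λ i → f i m)) n ≡ ∑ N (λ i → shift a (f i) n)
shift-∑ zero    N f n       = refl
shift-∑ (suc a) N f zero    = sym (∑-zero N)
shift-∑ (suc a) N f (suc n) = shift-∑ a N f n

-- Multiplication by 1 − q^a.
D : ℕ → PS → PS
D a f = f -ₚ shift a f

D-cong : ∀ a {f g} → f ≗ g → D a f ≗ D a g
D-cong a eq n = cong₂ _-_ (eq n) (shift-cong a eq n)

-- Both sides expand to f - q^a f - q^b f + q^(a+b) f.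
D-comm : ∀ a b f → D a (D b f) ≗ D b (D a f)
D-comm a b f n = begin
  f n - shift b f n - shift a (D b f) n                        ≡⟨ cong (_-_ (f n - shift b f n)) (expand a b) ⟩
  f n - shift b f n - (shift a f n - shift (a ℕ.+ b) f n)       ≡⟨ swap (f n) (shift b f n) (shift a f n) (shift (a ℕ.+ b) f n) ⟩
  f n - shift a f n - (shift b f n - shift (a ℕ.+ b) f n)       ≡⟨ cong (λ c → f n - shift a f n - (shift b f n - shift c f n)) (ℕₚ.+-comm a b) ⟩
  f n - shift a f n - (shift b f n - shift (b ℕ.+ a) f n)       ≡⟨ cong (_-_ (f n - shift a f n)) (expand b a) ⟨
  f n - shift a f n - shift b (D a f) n                        ∎
  where
  open ≡-Reasoning
  expand : ∀ a b → shift a (D b f) n ≡ shift a f n - shift (a ℕ.+ b) f n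
  expand a b = trans (shift-minus a f (shift b f) n) (cong (_-_ (shift a f n)) (shift-shift a b f n))
  swap : ∀ x y z w → x - y - (z - w) ≡ x - z - (y - w)
  swap = solve-∀

-- Cauchy products.

*ₚ-∑ : ∀ f g n → (f *ₚ g) n ≡ ∑ (suc n) (λ k → f k * g (n ∸ k))
*ₚ-∑ f g n = sum-applyUpTo (λ k → f k * g (n ∸ k)) id (suc n)

*ₚ-cong : ∀ {f f′ g g′} → f ≗ f′ → g ≗ g′ → (f *ₚ g) ≗ (f′ *ₚ g′)
*ₚ-cong {f} {f′} {g} {g′} p q n = begin
  (f *ₚ g) n                          ≡⟨ *ₚ-∑ f g n ⟩
  ∑ (suc n) (λ k → f k * g (n ∸ k))    ≡⟨ ∑-cong (suc n) (λ k _ → cong₂ _*_ (p k) (q (n ∸ k))) ⟩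
  ∑ (suc n) (λ k → f′ k * g′ (n ∸ k))  ≡⟨ *ₚ-∑ f′ g′ n ⟨
  (f′ *ₚ g′) n                        ∎
  where open ≡-Reasoning

*ₚ-minusˡ : ∀ f h g → ((f -ₚ h) *ₚ g) ≗ ((f *ₚ g) -ₚ (h *ₚ g))
*ₚ-minusˡ f h g n = begin
  ((f -ₚ h) *ₚ g) n                                         ≡⟨ *ₚ-∑ (f -ₚ h) g n ⟩
  ∑ (suc n) (λ k → (f k - h k) * g (n ∸ k))                  ≡⟨ ∑-cong (suc n) (λ k _ → distrib (f k) (h k) (g (n ∸ k))) ⟩
  ∑ (suc n) (λ k → f k * g (n ∸ k) - h k * g (n ∸ k))        ≡⟨ ∑-minus (suc n) (λ k → f k * g (n ∸ k)) (λ k → h k * g (n ∸ k)) ⟩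
  ∑ (suc n) (λ k → f k * g (n ∸ k)) - ∑ (suc n) (λ k → h k * g (n ∸ k))                                                     ≡⟨ cong₂ _-_ (*ₚ-∑ f g n) (*ₚ-∑ h g n) ⟨
  (f *ₚ g) n - (h *ₚ g) n                                   ∎
  where
  open ≡-Reasoning
  distrib : ∀ a b c → (a - b) * c ≡ a * c - b * c
  distrib = solve-∀

*ₚ-minusʳ : ∀ f g h → (f *ₚ (g -ₚ h)) ≗ ((f *ₚ g) -ₚ (f *ₚ h))
*ₚ-minusʳ f g h n = begin
  (f *ₚ (g -ₚ h)) n                                         ≡⟨ *ₚ-∑ f (g -ₚ h) n ⟩
  ∑ (suc n) (λ k → f k * (g (n ∸ k) - h (n ∸ k)))            ≡⟨ ∑-cong (suc n) (λ k _ → distrib (f k) (g (n ∸ k)) (h (n ∸ k))) ⟩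
  ∑ (suc n) (λ k → f k * g (n ∸ k) - f k * h (n ∸ k))        ≡⟨ ∑-minus (suc n) (λ k → f k * g (n ∸ k)) (λ k → f k * h (n ∸ k)) ⟩
  ∑ (suc n) (λ k → f k * g (n ∸ k)) - ∑ (suc n) (λ k → f k * h (n ∸ k))                                                     ≡⟨ cong₂ _-_ (*ₚ-∑ f g n) (*ₚ-∑ f h n) ⟨
  (f *ₚ g) n - (f *ₚ h) n                                   ∎
  where
  open ≡-Reasoning
  distrib : ∀ a b c → a * (b - c) ≡ a * b - a * c
  distrib = solve-∀

*ₚ-identityˡ : ∀ g → (1ₚ *ₚ g) ≗ g
*ₚ-identityˡ g n = begin
  (1ₚ *ₚ g) n                                   ≡⟨ *ₚ-∑ 1ₚ g n ⟩
  1ℤ * g n + ∑ n (λ k → 0ℤ * g (n ∸ suc k))      ≡⟨ cong₂ _+_ (ℤₚ.*-identityˡ (g n)) (∑-zero n) ⟩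
  g n + 0ℤ                                      ≡⟨ ℤₚ.+-identityʳ (g n) ⟩
  g n                                           ∎
  where open ≡-Reasoning

shift-*ₚˡ : ∀ a f g → (shift a f *ₚ g) ≗ shift a (f *ₚ g)
shift-*ₚˡ zero    f g n       = refl
shift-*ₚˡ (suc a) f g zero    = refl
shift-*ₚˡ (suc a) f g (suc n) = begin
  (shift (suc a) f *ₚ g) (suc n)                      ≡⟨ *ₚ-∑ (shift (suc a) f) g (suc n) ⟩
  0ℤ + ∑ (suc n) (λ k → shift a f k * g (n ∸ k))       ≡⟨ ℤₚ.+-identityˡ _ ⟩
  ∑ (suc n) (λ k → shift a f k * g (n ∸ k))            ≡⟨ *ₚ-∑ (shift a f) g n ⟨
  (shift a f *ₚ g) n                                  ≡⟨ shift-*ₚˡ a f g n ⟩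
  shift a (f *ₚ g) n                                  ∎
  where open ≡-Reasoning

shift-*ₚʳ : ∀ a f g → (f *ₚ shift a g) ≗ shift a (f *ₚ g)
shift-*ₚʳ zero    f g n       = refl
shift-*ₚʳ (suc a) f g zero    = trans (ℤₚ.+-identityʳ _) (ℤₚ.*-zeroʳ (f 0))
shift-*ₚʳ (suc a) f g (suc n) = begin
  (f *ₚ shift (suc a) g) (suc n)                      ≡⟨ *ₚ-∑ f (shift (suc a) g) (suc n) ⟩
  -- The last summand evaluates `shift (suc a) g` at exponent 0, where it vanishes; in all the
  -- others the shift loses one step.
  ∑ (suc (suc n)) t                                   ≡⟨ ∑-last (suc n) t ⟩
  ∑ (suc n) t + t (suc n)                             ≡⟨ cong₂ _+_ (∑-cong (suc n) inner) final ⟩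
  ∑ (suc n) (λ k → f k * shift a g (n ∸ k)) + 0ℤ       ≡⟨ ℤₚ.+-identityʳ _ ⟩
  ∑ (suc n) (λ k → f k * shift a g (n ∸ k))            ≡⟨ *ₚ-∑ f (shift a g) n ⟨
  (f *ₚ shift a g) n                                  ≡⟨ shift-*ₚʳ a f g n ⟩
  shift a (f *ₚ g) n                                  ∎
  where
  open ≡-Reasoning
  t : ℕ → ℤ
  t k = f k * shift (suc a) g (suc n ∸ k)
  inner : ∀ k → k ℕ.< suc n → t k ≡ f k * shift a g (n ∸ k)
  inner k (s≤s k≤n) = cong (λ m → f k * shift (suc a) g m) (ℕₚ.+-∸-assoc 1 k≤n)
  final : t (suc n) ≡ 0ℤ
  final = trans (cong (λ m → f (suc n) * shift (suc a) g m) (ℕₚ.n∸n≡0 n)) (ℤₚ.*-zeroʳ (f (suc n)))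

-- Lets the factor 1 - q^a pass from one side of a product to the other. This takes the place of
-- associativity and commutativity of `_*ₚ_`.
D-*ₚ : ∀ a f g → (f *ₚ D a g) ≗ (D a f *ₚ g)
D-*ₚ a f g n = begin
  (f *ₚ D a g) n                        ≡⟨ *ₚ-minusʳ f g (shift a g) n ⟩
  (f *ₚ g) n - (f *ₚ shift a g) n       ≡⟨ cong (_-_ ((f *ₚ g) n)) (trans (shift-*ₚʳ a f g n) (sym (shift-*ₚˡ a f g n))) ⟩
  (f *ₚ g) n - (shift a f *ₚ g) n       ≡⟨ *ₚ-minusˡ f (shift a f) g n ⟨
  (D a f *ₚ g) n                        ∎
  where open ≡-Reasoning

shift-1-diag : ∀ a → shift a 1ₚ a ≡ 1ℤ
shift-1-diag zero    = refl
shift-1-diag (suc a) = shift-1-diag a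

shift-1-off : ∀ a n → a ≢ n → shift a 1ₚ n ≡ 0ℤ
shift-1-off zero    zero    ne = contradiction refl ne
shift-1-off zero    (suc n) ne = refl
shift-1-off (suc a) zero    ne = refl
shift-1-off (suc a) (suc n) ne = shift-1-off a n (ne ∘ cong suc)

X^≗shift : ∀ a → X^ a ≗ shift a 1ₚ
X^≗shift a n with a ℕ.≟ n
... | yes refl = sym (shift-1-diag a)
... | no  a≢n  = sym (shift-1-off a n a≢n)

X^-*ₚ : ∀ a g → (X^ a *ₚ g) ≗ shift a g
X^-*ₚ a g n = begin
  (X^ a *ₚ g) n             ≡⟨ *ₚ-cong {g = g} (X^≗shift a) (λ _ → refl) n ⟩
  (shift a 1ₚ *ₚ g) n       ≡⟨ shift-*ₚˡ a 1ₚ g n ⟩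
  shift a (1ₚ *ₚ g) n       ≡⟨ shift-cong a (*ₚ-identityˡ g) n ⟩
  shift a g n               ∎
  where open ≡-Reasoning

1-X^-*ₚ : ∀ a g → ((1ₚ -ₚ X^ a) *ₚ g) ≗ D a g
1-X^-*ₚ a g n = trans (*ₚ-minusˡ 1ₚ (X^ a) g n) (cong₂ _-_ (*ₚ-identityˡ g n) (X^-*ₚ a g n))

-- Multiplicative inverses and their uniqueness.

sum-zipWith-invRev : ∀ f g n →
  sumℤ (zipWith (λ j x → f (suc j) * x) (applyUpTo g (suc n)) (invRev f n)) ≡
  ∑ (suc n) (λ j → f (suc (g j)) * inv f (n ∸ j))
sum-zipWith-invRev f g zero    = refl
-- `invRev` lists the coefficients from the newest down, so position j holds the coefficient at n -
-- j. The arbitrary `g` absorbs the reindexing by `suc` in the tail.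
sum-zipWith-invRev f g (suc n) = cong (f (suc (g 0)) * inv f (suc n) +_) (sum-zipWith-invRev f (g ∘ suc) n)

inv-suc : ∀ f n → inv f (suc n) ≡ - ∑ (suc n) (λ j → f (suc j) * inv f (n ∸ j))
inv-suc f n = cong -_ (sum-zipWith-invRev f id n)

*ₚ-inverseʳ : ∀ f → f 0 ≡ 1ℤ → (f *ₚ inv f) ≗ 1ₚ
*ₚ-inverseʳ f f0 zero    = trans (ℤₚ.+-identityʳ _) (trans (ℤₚ.*-identityʳ (f 0)) f0)
*ₚ-inverseʳ f f0 (suc n) = begin
  (f *ₚ inv f) (suc n)              ≡⟨ *ₚ-∑ f (inv f) (suc n) ⟩
  f 0 * inv f (suc n) + S           ≡⟨ cong₂ (λ x y → x * y + S) f0 (inv-suc f n) ⟩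
  1ℤ * - S + S                      ≡⟨ cancel S ⟩
  0ℤ                                ∎
  where
  open ≡-Reasoning
  S = ∑ (suc n) (λ j → f (suc j) * inv f (n ∸ j))
  cancel : ∀ x → 1ℤ * - x + x ≡ 0ℤ
  cancel = solve-∀

-- In the coefficient of q^n in f g, the unknown `g n` occurs only with the factor `f 0`, which is
-- 1. Hence `g` obeys the recursion that defines `inv f`.
inv-unique : ∀ f g → f 0 ≡ 1ℤ → (f *ₚ g) ≗ 1ₚ → g ≗ inv f
inv-unique f g f0 fg = <-rec (λ n → g n ≡ inv f n) step
  where
  open ≡-Reasoning
  solveFor : ∀ x y → 1ℤ * x + y ≡ 0ℤ → x ≡ - y
  solveFor x y eq = trans (isolate x y) (trans (cong (λ z → z - y) eq) (ℤₚ.+-identityˡ (- y)))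
    where
    isolate : ∀ x y → x ≡ 1ℤ * x + y - y
    isolate = solve-∀
  step : ∀ n → (∀ {m} → m ℕ.< n → g m ≡ inv f m) → g n ≡ inv f n
  step zero    _  = begin
    g 0               ≡⟨ ℤₚ.*-identityˡ (g 0) ⟨
    1ℤ * g 0          ≡⟨ cong (_* g 0) f0 ⟨
    f 0 * g 0         ≡⟨ ℤₚ.+-identityʳ _ ⟨
    f 0 * g 0 + 0ℤ    ≡⟨ fg 0 ⟩
    1ℤ                ∎
  step (suc n) ih = begin
    g (suc n)                                          ≡⟨ solveFor (g (suc n)) S (trans (cong (λ x → x * g (suc n) + S) (sym f0)) (trans (sym (*ₚ-∑ f g (suc n))) (fg (suc n)))) ⟩
    - ∑ (suc n) (λ j → f (suc j) * g (n ∸ j))           ≡⟨ cong -_ (∑-cong (suc n) λ j _ → cong (f (suc j) *_) (ih (s≤s (ℕₚ.m∸n≤m n j)))) ⟩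
    - ∑ (suc n) (λ j → f (suc j) * inv f (n ∸ j))       ≡⟨ inv-suc f n ⟨
    inv f (suc n)                                      ∎
    where S = ∑ (suc n) (λ j → f (suc j) * g (n ∸ j))

-- If g = (1 - q^a) f, then f · (1 - q^a) g⁻¹ = g · g⁻¹ = 1, and uniqueness of the inverse applies.
-- Each factor of a q-Pochhammer symbol thereby becomes a recurrence for its reciprocal.
inv-D : ∀ a f g → f 0 ≡ 1ℤ → g 0 ≡ 1ℤ → g ≗ D a f → D a (inv g) ≗ inv f
inv-D a f g f0 g0 g≗Df = inv-unique f (D a (inv g)) f0 λ n → begin
  (f *ₚ D a (inv g)) n   ≡⟨ D-*ₚ a f (inv g) n ⟩
  (D a f *ₚ inv g) n     ≡⟨ *ₚ-cong {g = inv g} g≗Df (λ _ → refl) n ⟨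
  (g *ₚ inv g) n         ≡⟨ *ₚ-inverseʳ g g0 n ⟩
  1ₚ n                   ∎
  where open ≡-Reasoning

-- Recurrences for q-Pochhammer symbols and their reciprocals.

prodₚ-applyUpTo : ∀ (F : ℕ → PS) s t (g h : ℕ → ℕ) → (∀ i → s ℕ.+ g i ≡ t ℕ.+ h i) → ∀ k →
  prodₚ (map (λ i → F (s ℕ.+ i)) (applyUpTo g k)) ≡ prodₚ (map (λ i → F (t ℕ.+ i)) (applyUpTo h k))
prodₚ-applyUpTo F s t g h eq zero    = refl
prodₚ-applyUpTo F s t g h eq (suc k) =
  cong₂ _*ₚ_ (cong F (eq 0)) (prodₚ-applyUpTo F s t (g ∘ suc) (h ∘ suc) (eq ∘ suc) k)

qPoch-bottom : ∀ s k → qPoch s (suc k) ≗ D s (qPoch (suc s) k)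
qPoch-bottom s k n = begin
  qPoch s (suc k) n                                ≡⟨ cong (λ f → f n) (cong₂ _*ₚ_
                                                        (cong (λ a → 1ₚ -ₚ X^ a) (ℕₚ.+-identityʳ s))
                                                        -- The exponents `s + suc i` and `suc s + i`
                                                        -- agree as numbers, so the two tails are
                                                        -- equal as functions and not merely
                                                        -- pointwise.
                                                        (prodₚ-applyUpTo (λ a → 1ₚ -ₚ X^ a) s (suc s) suc id (ℕₚ.+-suc s) k)) ⟩
  ((1ₚ -ₚ X^ s) *ₚ qPoch (suc s) k) n              ≡⟨ 1-X^-*ₚ s (qPoch (suc s) k) n ⟩
  D s (qPoch (suc s) k) n                          ∎
  where open ≡-Reasoning

-- The product unfolds from its lowest factor only. The induction splits that factor off, finds the
-- top one in the shorter product and exchanges the two by `D-comm`.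
qPoch-top : ∀ s k → qPoch s (suc k) ≗ D (s ℕ.+ k) (qPoch s k)
qPoch-top s zero    n = subst (λ a → qPoch s 1 n ≡ D a 1ₚ n) (sym (ℕₚ.+-identityʳ s)) (qPoch-bottom s 0 n)
qPoch-top s (suc k) n = begin
  qPoch s (suc (suc k)) n                          ≡⟨ qPoch-bottom s (suc k) n ⟩
  D s (qPoch (suc s) (suc k)) n                    ≡⟨ D-cong s (qPoch-top (suc s) k) n ⟩
  D s (D (suc s ℕ.+ k) (qPoch (suc s) k)) n        ≡⟨ D-comm s (suc s ℕ.+ k) (qPoch (suc s) k) n ⟩
  D (suc s ℕ.+ k) (D s (qPoch (suc s) k)) n        ≡⟨ cong (λ a → D a (D s (qPoch (suc s) k)) n) (ℕₚ.+-suc s k) ⟨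
  D (s ℕ.+ suc k) (D s (qPoch (suc s) k)) n        ≡⟨ D-cong (s ℕ.+ suc k) (qPoch-bottom s k) n ⟨
  D (s ℕ.+ suc k) (qPoch s (suc k)) n              ∎
  where open ≡-Reasoning

qPoch-constant : ∀ s k → qPoch (suc s) k 0 ≡ 1ℤ
qPoch-constant s zero    = refl
qPoch-constant s (suc k) = trans (qPoch-bottom (suc s) k 0) (trans (ℤₚ.+-identityʳ _) (qPoch-constant (suc s) k))

-- The generating function of partitions into parts from {s, …, s + k − 1}.
P : ℕ → ℕ → PS
P s k = inv (qPoch s k)

solve-shift : ∀ {x y z : ℤ} → x - y ≡ z → x ≡ z + y
solve-shift {x} {y} refl = isolate x y
  where
  isolate : ∀ x y → x ≡ x - y + y
  isolate = solve-∀

-- Either the least allowed part `suc s` does not occur, or one copy of it can be removed. `P-top`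
-- makes the same distinction for the greatest allowed part. Both are read off from `inv-D`, without
-- bijections.
P-bottom : ∀ s k n → P (suc s) (suc k) n ≡ P (suc (suc s)) k n + shift (suc s) (P (suc s) (suc k)) n
P-bottom s k n = solve-shift (inv-D (suc s) (qPoch (suc (suc s)) k) (qPoch (suc s) (suc k))
  (qPoch-constant (suc s) k) (qPoch-constant s (suc k)) (qPoch-bottom (suc s) k) n)

P-top : ∀ s k n → P (suc s) (suc k) n ≡ P (suc s) k n + shift (suc s ℕ.+ k) (P (suc s) (suc k)) n
P-top s k n = solve-shift (inv-D (suc s ℕ.+ k) (qPoch (suc s) k) (qPoch (suc s) (suc k))
  (qPoch-constant s k) (qPoch-constant s (suc k)) (qPoch-top (suc s) k) n)

P-zero : ∀ s → P s 0 ≗ 1ₚ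
P-zero s n = sym (inv-unique 1ₚ 1ₚ refl (*ₚ-identityˡ 1ₚ) n)

-- Coefficientwise inequalities between partition series.

shift-descent : ∀ {a m n} → suc a ℕ.+ m ℕ.≤ n → m ℕ.< n
shift-descent {a} {m} le = ℕₚ.≤-trans (s≤s (ℕₚ.m≤n+m m a)) le

1ₚ-nonneg : ∀ n → 0ℤ ≤ 1ₚ n
1ₚ-nonneg zero    = ℤ.+≤+ z≤n
1ₚ-nonneg (suc n) = ℤₚ.≤-refl

-- Two inductions are nested: the first term of `P-bottom` allows fewer parts, the second is the
-- same series at a smaller exponent.
P-nonneg : ∀ s k n → 0ℤ ≤ P (suc s) k n
P-nonneg s zero    n = subst (0ℤ ≤_) (sym (P-zero (suc s) n)) (1ₚ-nonneg n)
P-nonneg s (suc k) = <-rec (λ n → 0ℤ ≤ P (suc s) (suc k) n) λ n ih →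
  subst (0ℤ ≤_) (sym (P-bottom s k n)) (ℤₚ.+-mono-≤ (P-nonneg (suc s) k n)
    (subst (_≤ shift (suc s) (P (suc s) (suc k)) n) (shift-zero (suc s) n)
      (shift-rel _≤_ ℤₚ.≤-refl (suc s) n λ m le → ih (shift-descent {s} le))))

P-mono : ∀ s k n → P (suc (suc s)) k n ≤ P (suc s) (suc k) n
P-mono s k n = subst (P (suc (suc s)) k n ≤_) (sym (P-bottom s k n))
  (subst (_≤ P (suc (suc s)) k n + shift (suc s) (P (suc s) (suc k)) n) (ℤₚ.+-identityʳ _)
    (ℤₚ.+-monoʳ-≤ (P (suc (suc s)) k n) (shift-nonneg (suc s) (P-nonneg s (suc k)) n)))

-- Every nonempty partition contains some part, and removing it leaves a partition.
P-remove-part : ∀ s k n → P (suc s) k n ≤ 1ₚ n + ∑ k (λ i → shift (suc s ℕ.+ i) (P (suc s) k) n)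
P-remove-part s zero    n = ℤₚ.≤-reflexive (trans (P-zero (suc s) n) (sym (ℤₚ.+-identityʳ _)))
P-remove-part s (suc k) n = begin
  P (suc s) (suc k) n                                          ≡⟨ P-bottom s k n ⟩
  P (suc (suc s)) k n + S                                      ≤⟨ ℤₚ.+-monoˡ-≤ S (P-remove-part (suc s) k n) ⟩
  1ₚ n + ∑ k (λ i → shift (suc (suc s) ℕ.+ i) (P (suc (suc s)) k) n) + S
      -- The induction hypothesis removes a part from partitions that avoid `suc s`; `P-mono`
      -- readmits this part in what remains.
      ≤⟨ ℤₚ.+-monoˡ-≤ S (ℤₚ.+-monoʳ-≤ (1ₚ n) (∑-mono k λ i → shift-mono (suc (suc s) ℕ.+ i) (P-mono s k) n)) ⟩
  1ₚ n + ∑ k (λ i → shift (suc (suc s) ℕ.+ i) (P (suc s) (suc k)) n) + S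
      ≡⟨ rotate (1ₚ n) (∑ k (λ i → shift (suc (suc s) ℕ.+ i) (P (suc s) (suc k)) n)) S ⟩
  1ₚ n + (S + ∑ k (λ i → shift (suc (suc s) ℕ.+ i) (P (suc s) (suc k)) n))
      ≡⟨ cong (1ₚ n +_) (cong₂ _+_
           (cong (λ a → shift a (P (suc s) (suc k)) n) (ℕₚ.+-identityʳ (suc s)))
           (∑-cong k λ i _ → cong (λ a → shift a (P (suc s) (suc k)) n) (ℕₚ.+-suc (suc s) i))) ⟨
  1ₚ n + ∑ (suc k) (λ i → shift (suc s ℕ.+ i) (P (suc s) (suc k)) n)  ∎
  where
  open ℤₚ.≤-Reasoning
  S = shift (suc s) (P (suc s) (suc k)) n
  rotate : ∀ a b c → a + b + c ≡ a + (c + b)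
  rotate = solve-∀

-- Partitions with smallest part s and largest part at most s + L.
R : ℕ → ℕ → PS
R L s = shift s (P s (suc L))

-- `P-bottom` and `P-top` expand the same series `P (suc s) (suc L)`. Equating the two expansions
-- gives the identity, once the shift by `suc s + L` is split in two.
R-telescope : ∀ L s n → R L (suc s) n ≡ shift L (R L (suc s)) n + (P (suc s) L n - P (suc (suc s)) L n)
R-telescope L s n = begin
  shift (suc s) F n                                                     ≡⟨ add-sub (P (suc (suc s)) L n) (shift (suc s) F n) ⟩
  P (suc (suc s)) L n + shift (suc s) F n - P (suc (suc s)) L n         ≡⟨ cong (λ z → z - P (suc (suc s)) L n) (trans (sym (P-bottom s L n)) (P-top s L n)) ⟩
  P (suc s) L n + shift (suc s ℕ.+ L) F n - P (suc (suc s)) L n         ≡⟨ rearrange (P (suc s) L n) (shift (suc s ℕ.+ L) F n) (P (suc (suc s)) L n) ⟩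
  shift (suc s ℕ.+ L) F n + (P (suc s) L n - P (suc (suc s)) L n)       ≡⟨ cong (λ a → shift a F n + (P (suc s) L n - P (suc (suc s)) L n)) (ℕₚ.+-comm (suc s) L) ⟩
  shift (L ℕ.+ suc s) F n + (P (suc s) L n - P (suc (suc s)) L n)       ≡⟨ cong (_+ (P (suc s) L n - P (suc (suc s)) L n)) (shift-shift L (suc s) F n) ⟨
  shift L (shift (suc s) F) n + (P (suc s) L n - P (suc (suc s)) L n)   ∎
  where
  open ≡-Reasoning
  F = P (suc s) (suc L)
  add-sub : ∀ x y → y ≡ x + y - x
  add-sub = solve-∀
  rearrange : ∀ x y z → x + y - z ≡ y + (x - z)
  rearrange = solve-∀

R-nonneg : ∀ L s n → 0ℤ ≤ R L (suc s) n
R-nonneg L s = shift-nonneg (suc s) (P-nonneg s (suc L))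

-- The series T truncated to 2 ≤ s ≤ M + 1, which keeps every sum finite.
∑R : ℕ → ℕ → PS
∑R L M n = ∑ M (λ i → R L (suc (suc i)) n)

-- Summing `R-telescope` over s. The truncation leaves `P (suc (suc M)) L` where the infinite sum
-- would leave 1.
∑R-telescope : ∀ L M n → ∑R L M n ≡ shift L (∑R L M) n + (P 2 L n - P (suc (suc M)) L n)
∑R-telescope L M n = begin
  ∑ M (λ i → R L (suc (suc i)) n)
    ≡⟨ ∑-cong M (λ i _ → R-telescope L (suc i) n) ⟩
  ∑ M (λ i → shift L (R L (suc (suc i))) n + (P (suc (suc i)) L n - P (suc (suc (suc i))) L n))
    ≡⟨ ∑-+ M (λ i → shift L (R L (suc (suc i))) n) (λ i → P (suc (suc i)) L n - P (suc (suc (suc i))) L n) ⟩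
  ∑ M (λ i → shift L (R L (suc (suc i))) n) + ∑ M (λ i → P (suc (suc i)) L n - P (suc (suc (suc i))) L n)
    ≡⟨ cong₂ _+_ (sym (shift-∑ L M (λ i → R L (suc (suc i))) n)) (∑-telescope M (λ i → P (suc (suc i)) L n)) ⟩
  shift L (∑R L M) n + (P 2 L n - P (suc (suc M)) L n)
    ∎
  where open ≡-Reasoning

-- Since `P 2 L` is (1 - q) F with F = `P 1 (suc L)`, each summand in `P-remove-part` is a
-- difference of consecutive shifts of F, and the sum telescopes.
P-2-bound : ∀ L n → P 2 L n ≤ 1ₚ n + (shift 2 (P 1 (suc L)) n - shift (suc (suc L)) (P 1 (suc L)) n)
P-2-bound L n = subst (λ z → P 2 L n ≤ 1ₚ n + z)
  (trans (∑-cong L λ i _ → difference i) (∑-telescope L λ i → shift (suc (suc i)) F n))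
  (P-remove-part 1 L n)
  where
  open ≡-Reasoning
  F = P 1 (suc L)
  cancel : ∀ x y → x ≡ x + y - y
  cancel = solve-∀
  P-2 : P 2 L ≗ D 1 F
  P-2 m = trans (cancel (P 2 L m) (shift 1 F m)) (cong (λ z → z - shift 1 F m) (sym (P-bottom 0 L m)))
  difference : ∀ i → shift (suc (suc i)) (P 2 L) n ≡ shift (suc (suc i)) F n - shift (suc (suc (suc i))) F n
  difference i = begin
    shift (suc (suc i)) (P 2 L) n                                  ≡⟨ shift-cong (suc (suc i)) P-2 n ⟩
    shift (suc (suc i)) (D 1 F) n                                  ≡⟨ shift-minus (suc (suc i)) F (shift 1 F) n ⟩
    shift (suc (suc i)) F n - shift (suc (suc i)) (shift 1 F) n    ≡⟨ cong (_-_ (shift (suc (suc i)) F n)) (shift-shift (suc (suc i)) 1 F n) ⟩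
    shift (suc (suc i)) F n - shift (suc (suc i) ℕ.+ 1) F n        ≡⟨ cong (λ a → shift (suc (suc i)) F n - shift (suc (suc a)) F n) (ℕₚ.+-comm i 1) ⟩
    shift (suc (suc i)) F n - shift (suc (suc (suc i))) F n        ∎

-- Writing L as `suc l` makes the shift by L lower the exponent strictly, so that strong induction
-- applies. The remainder from the truncation is nonnegative and is dropped, so the bound is uniform
-- in `M`.
∑R-bound : ∀ l M n → ∑R (suc l) M n ≤ shift 2 (P 1 (suc (suc l))) n
∑R-bound l M = <-rec (λ n → ∑R L M n ≤ shift 2 F n) step
  where
  open ℤₚ.≤-Reasoning
  L = suc l
  F = P 1 (suc L)
  cancel : ∀ x y → x + (0ℤ + (y - x)) ≡ y
  cancel = solve-∀
  step : ∀ n → (∀ {m} → m ℕ.< n → ∑R L M m ≤ shift 2 F m) → ∑R L M n ≤ shift 2 F n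
  -- Exponent 0 is separate because `1ₚ` contributes 1 there; at positive exponents it contributes
  -- the `0ℤ` seen below.
  step zero    _  = ℤₚ.≤-reflexive (∑-zero M)
  step (suc n) ih = begin
    ∑R L M (suc n)
      ≡⟨ ∑R-telescope L M (suc n) ⟩
    shift L (∑R L M) (suc n) + (P 2 L (suc n) - P (suc (suc M)) L (suc n))
      ≤⟨ ℤₚ.+-mono-≤
           (shift-rel _≤_ ℤₚ.≤-refl L (suc n) λ m le → ih (shift-descent {l} le))
           (ℤₚ.i-j≤i (P 2 L (suc n)) (P (suc (suc M)) L (suc n)) {{ℤ.nonNegative (P-nonneg (suc M) L (suc n))}}) ⟩
    shift L (shift 2 F) (suc n) + P 2 L (suc n)
      ≤⟨ ℤₚ.+-monoʳ-≤ (shift L (shift 2 F) (suc n)) (P-2-bound L (suc n)) ⟩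
    shift L (shift 2 F) (suc n) + (0ℤ + (shift 2 F (suc n) - shift (suc (suc L)) F (suc n)))
      ≡⟨ cong (_+ (0ℤ + (shift 2 F (suc n) - shift (suc (suc L)) F (suc n))))
           (trans (shift-shift L 2 F (suc n)) (cong (λ a → shift a F (suc n)) (ℕₚ.+-comm L 2))) ⟩
    shift (suc (suc L)) F (suc n) + (0ℤ + (shift 2 F (suc n) - shift (suc (suc L)) F (suc n)))
      ≡⟨ cancel (shift (suc (suc L)) F (suc n)) (shift 2 F (suc n)) ⟩
    shift 2 F (suc n)
      ∎

-- With F = `P 1 (suc L)`, `P-bottom` gives F = `P 2 L` + q F, hence q F ≤ F. Multiplying by q gives
-- the claim.
shift-2≤R-1 : ∀ L n → shift 2 (P 1 (suc L)) n ≤ R L 1 n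
shift-2≤R-1 L n = subst (_≤ R L 1 n) (shift-shift 1 1 (P 1 (suc L)) n)
  (shift-mono 1 (λ m → subst (shift 1 (P 1 (suc L)) m ≤_) (sym (P-bottom 0 L m))
    (ℤₚ.i≤j+i (shift 1 (P 1 (suc L)) m) (P 2 L m) {{ℤ.nonNegative (P-nonneg 1 L m)}})) n)

-- Signs and the alternating sum.

neg1^-±1 : ∀ k → neg1^ k ≡ 1ℤ ⊎ neg1^ k ≡ - 1ℤ
neg1^-±1 zero    = inj₁ refl
neg1^-±1 (suc k) with neg1^-±1 k
... | inj₁ e = inj₂ (cong -_ e)
... | inj₂ e = inj₁ (cong -_ e)

neg≤neg1^* : ∀ k {x} → 0ℤ ≤ x → - x ≤ neg1^ k * x
neg≤neg1^* k {x} 0≤x with neg1^-±1 k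
... | inj₁ e = subst (- x ≤_) (sym (trans (cong (_* x) e) (ℤₚ.*-identityˡ x)))
                 (ℤₚ.≤-trans (ℤₚ.neg-mono-≤ 0≤x) 0≤x)
... | inj₂ e = ℤₚ.≤-reflexive (sym (trans (cong (_* x) e) (ℤₚ.-1*i≡-i x)))

-- The term s = 1 has sign +1. Every later term is at least -R s whatever its sign, so parities need
-- not be tracked.
alternating-nonneg : ∀ l n → 0ℤ ≤ ∑ n (λ i → neg1^ (suc (suc i)) * R (suc l) (suc i) n)
alternating-nonneg l zero    = ℤₚ.≤-refl
alternating-nonneg l (suc m) = begin
  0ℤ
    ≤⟨ ℤₚ.i≤j⇒0≤j-i (ℤₚ.≤-trans (∑R-bound l m n) (shift-2≤R-1 (suc l) n)) ⟩
  R (suc l) 1 n - ∑R (suc l) m n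
    ≡⟨ cong₂ _+_ (ℤₚ.*-identityˡ (R (suc l) 1 n)) (∑-neg m (λ i → R (suc l) (suc (suc i)) n)) ⟨
  1ℤ * R (suc l) 1 n + ∑ m (λ i → - R (suc l) (suc (suc i)) n)
    ≤⟨ ℤₚ.+-monoʳ-≤ (1ℤ * R (suc l) 1 n) (∑-mono m λ i → neg≤neg1^* (suc (suc (suc i))) (R-nonneg (suc l) (suc i) n)) ⟩
  ∑ n (λ i → neg1^ (suc (suc i)) * R (suc l) (suc i) n)
    ∎
  where
  open ℤₚ.≤-Reasoning
  n = suc m

rhs-∑ : ∀ L n → rhs L n ≡ ∑ n (λ i → neg1^ (suc (suc i)) * R L (suc i) n)
rhs-∑ L n = begin
  rhs L n
    ≡⟨ cong sumℤ (map-∘ (upTo n)) ⟨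
  sumℤ (map (λ i → neg1^ (suc (suc i)) * (X^ (suc i) *ₚ P (suc i) (suc L)) n) (upTo n))
    ≡⟨ sum-applyUpTo (λ i → neg1^ (suc (suc i)) * (X^ (suc i) *ₚ P (suc i) (suc L)) n) id n ⟩
  ∑ n (λ i → neg1^ (suc (suc i)) * (X^ (suc i) *ₚ P (suc i) (suc L)) n)
    ≡⟨ ∑-cong n (λ i _ → cong (neg1^ (suc (suc i)) *_) (X^-*ₚ (suc i) (P (suc i) (suc L)) n)) ⟩
  ∑ n (λ i → neg1^ (suc (suc i)) * R L (suc i) n)
    ∎
  where open ≡-Reasoning

-- Sums over lists, and indicators of decidable propositions.

Σₗ : {A : Set} → List A → (A → ℤ) → ℤ
Σₗ xs f = sumℤ (map f xs)

module _ {A : Set} where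

  Σₗ-++ : ∀ xs ys (f : A → ℤ) → Σₗ (xs ++ ys) f ≡ Σₗ xs f + Σₗ ys f
  Σₗ-++ []       ys f = sym (ℤₚ.+-identityˡ _)
  Σₗ-++ (x ∷ xs) ys f = trans (cong (f x +_) (Σₗ-++ xs ys f)) (sym (ℤₚ.+-assoc (f x) (Σₗ xs f) (Σₗ ys f)))

  Σₗ-concatMap : ∀ {B : Set} (g : B → List A) xs (f : A → ℤ) →
                 Σₗ (concatMap g xs) f ≡ Σₗ xs (λ x → Σₗ (g x) f)
  Σₗ-concatMap g []       f = refl
  Σₗ-concatMap g (x ∷ xs) f = trans (Σₗ-++ (g x) (concatMap g xs) f) (cong (Σₗ (g x) f +_) (Σₗ-concatMap g xs f))

  Σₗ-cong : ∀ xs {f g : A → ℤ} → f ≗ g → Σₗ xs f ≡ Σₗ xs g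
  Σₗ-cong []       eq = refl
  Σₗ-cong (x ∷ xs) eq = cong₂ _+_ (eq x) (Σₗ-cong xs eq)

  Σₗ-*ˡ : ∀ xs c (f : A → ℤ) → Σₗ xs (λ x → c * f x) ≡ c * Σₗ xs f
  Σₗ-*ˡ []       c f = sym (ℤₚ.*-zeroʳ c)
  Σₗ-*ˡ (x ∷ xs) c f = trans (cong (c * f x +_) (Σₗ-*ˡ xs c f)) (sym (ℤₚ.*-distribˡ-+ c (f x) (Σₗ xs f)))

  Σₗ-minus : ∀ xs (f g : A → ℤ) → Σₗ xs (λ x → f x - g x) ≡ Σₗ xs f - Σₗ xs g
  Σₗ-minus []       f g = refl
  Σₗ-minus (x ∷ xs) f g = trans (cong (f x - g x +_) (Σₗ-minus xs f g)) (interchange (f x) (g x) (Σₗ xs f) (Σₗ xs g))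
    where
    interchange : ∀ a b c d → (a - b) + (c - d) ≡ (a + c) - (b + d)
    interchange = solve-∀

  Σₗ-∑ : ∀ xs n (F : ℕ → A → ℤ) → Σₗ xs (λ x → ∑ n (λ i → F i x)) ≡ ∑ n (λ i → Σₗ xs (F i))
  Σₗ-∑ []       n F = sym (∑-zero n)
  Σₗ-∑ (x ∷ xs) n F = trans (cong (∑ n (λ i → F i x) +_) (Σₗ-∑ xs n F)) (sym (∑-+ n (λ i → F i x) (λ i → Σₗ xs (F i))))

  Σₗ-shift : ∀ xs a (F : ℕ → A → ℤ) n →
             Σₗ xs (λ x → shift a (λ m → F m x) n) ≡ shift a (λ m → Σₗ xs (F m)) n
  Σₗ-shift xs zero    F n       = refl
  Σₗ-shift xs (suc a) F zero    = Σₗ-0 xs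
    where
    Σₗ-0 : ∀ xs → Σₗ {A} xs (λ _ → 0ℤ) ≡ 0ℤ
    Σₗ-0 []       = refl
    Σₗ-0 (x ∷ xs) = trans (ℤₚ.+-identityˡ _) (Σₗ-0 xs)
  Σₗ-shift xs (suc a) F (suc n) = Σₗ-shift xs a F n

𝟙 : {A : Set} → Dec A → ℤ
𝟙 (yes _) = 1ℤ
𝟙 (no _)  = 0ℤ

private variable A B : Set

𝟙-yes : (d : Dec A) → A → 𝟙 d ≡ 1ℤ
𝟙-yes (yes _) _ = refl
𝟙-yes (no ¬a) a = contradiction a ¬a

𝟙-no : (d : Dec A) → ¬ A → 𝟙 d ≡ 0ℤ
𝟙-no (yes a) ¬a = contradiction a ¬a
𝟙-no (no _)  _  = refl

𝟙-cong : (d : Dec A) (e : Dec B) → (A → B) → (B → A) → 𝟙 d ≡ 𝟙 e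
𝟙-cong (yes a) e to from = sym (𝟙-yes e (to a))
𝟙-cong (no ¬a) e to from = sym (𝟙-no e (¬a ∘ from))

𝟙-× : (d : Dec A) (e : Dec B) → 𝟙 (d ×-dec e) ≡ 𝟙 d * 𝟙 e
𝟙-× (yes a) (yes b) = refl
𝟙-× (yes a) (no ¬b) = refl
𝟙-× (no ¬a) e       = 𝟙-no (no ¬a ×-dec e) (λ (a , _) → ¬a a)

Σₗ-filter : {Q : A → Set} (Q? : Decidable Q) (xs : List A) (f : A → ℤ) →
            Σₗ (filter Q? xs) f ≡ Σₗ xs (λ x → 𝟙 (Q? x) * f x)
Σₗ-filter Q? []       f = refl
Σₗ-filter Q? (x ∷ xs) f with Q? x
... | yes _ = cong₂ _+_ (sym (ℤₚ.*-identityˡ (f x))) (Σₗ-filter Q? xs f)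
... | no  _ = trans (Σₗ-filter Q? xs f) (sym (ℤₚ.+-identityˡ _))

-- The last hypothesis covers an index `b` outside the range of summation, where the sum is 0.
∑-𝟙 : ∀ N b (g : ℕ → ℤ) → (N ℕ.≤ b → g b ≡ 0ℤ) → ∑ N (λ i → 𝟙 (i ℕ.≟ b) * g i) ≡ g b
∑-𝟙 zero    b       g out = sym (out z≤n)
∑-𝟙 (suc N) zero    g out = begin
  1ℤ * g 0 + ∑ N (λ i → 𝟙 (suc i ℕ.≟ 0) * g (suc i))  ≡⟨ cong₂ _+_ (ℤₚ.*-identityˡ (g 0)) (∑-zero N) ⟩
  g 0 + 0ℤ                                           ≡⟨ ℤₚ.+-identityʳ (g 0) ⟩
  g 0                                                ∎
  where open ≡-Reasoning
∑-𝟙 (suc N) (suc b) g out = begin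
  0ℤ + ∑ N (λ i → 𝟙 (suc i ℕ.≟ suc b) * g (suc i))   ≡⟨ ℤₚ.+-identityˡ _ ⟩
  ∑ N (λ i → 𝟙 (suc i ℕ.≟ suc b) * g (suc i))        ≡⟨ ∑-cong N (λ i _ → cong (_* g (suc i))
                                                          (𝟙-cong (suc i ℕ.≟ suc b) (i ℕ.≟ b) ℕₚ.suc-injective (cong suc))) ⟩
  ∑ N (λ i → 𝟙 (i ℕ.≟ b) * g (suc i))                ≡⟨ ∑-𝟙 N b (g ∘ suc) (out ∘ s≤s) ⟩
  g (suc b)                                          ∎
  where open ≡-Reasoning

-- Counting partitions with parts in an interval.

Partition? : ∀ n π → Dec (Linked ℕ._≥_ π × norm π ≡ n)
Partition? n π = linked? ℕ._≥?_ π ×-dec (norm π ℕ.≟ n)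

Bounded? : ∀ s b π → Dec (All (s ℕ.≤_) π × All (ℕ._< b) π)
Bounded? s b π = all? (s ℕ.≤?_) π ×-dec all? (ℕ._<? b) π

-- The upper bound `b` is exclusive, so `b = s` leaves no part to choose.
χ : ℕ → ℕ → ℕ → List ℕ → ℤ
χ s b n π = 𝟙 (Partition? n π ×-dec Bounded? s b π)

-- The head of a weakly decreasing list is its largest part, so the tail is a partition of n - x
-- with parts below `suc x`. If x exceeds n, both sides vanish; `shift` records this, whereas
-- `n ∸ x` would silently become 0.
χ-∷ : ∀ s b n x π → χ s b n (x ∷ π) ≡
      𝟙 (s ℕ.≤? x) * 𝟙 (x ℕ.<? b) * shift x (λ m → χ s (suc x) m π) n
χ-∷ s b n x π with x ℕ.≤? n
... | no x≰n = begin
  χ s b n (x ∷ π)                                                        ≡⟨ 𝟙-no (Partition? n (x ∷ π) ×-dec Bounded? s b (x ∷ π)) (λ ((_ , eq) , _) → x≰n (subst (x ℕ.≤_) eq (ℕₚ.m≤m+n x (norm π)))) ⟩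
  0ℤ                                                                     ≡⟨ ℤₚ.*-zeroʳ (𝟙 (s ℕ.≤? x) * 𝟙 (x ℕ.<? b)) ⟨
  𝟙 (s ℕ.≤? x) * 𝟙 (x ℕ.<? b) * 0ℤ                                       ≡⟨ cong (𝟙 (s ℕ.≤? x) * 𝟙 (x ℕ.<? b) *_) (shift-vanish x (λ m → χ s (suc x) m π) n (ℕₚ.≰⇒> x≰n)) ⟨
  𝟙 (s ℕ.≤? x) * 𝟙 (x ℕ.<? b) * shift x (λ m → χ s (suc x) m π) n        ∎
  where open ≡-Reasoning
... | yes x≤n = begin
  χ s b n (x ∷ π)                                                        ≡⟨ 𝟙-cong (Partition? n (x ∷ π) ×-dec Bounded? s b (x ∷ π)) ((s ℕ.≤? x ×-dec x ℕ.<? b) ×-dec tail?) to from ⟩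
  𝟙 ((s ℕ.≤? x ×-dec x ℕ.<? b) ×-dec tail?)                              ≡⟨ 𝟙-× (s ℕ.≤? x ×-dec x ℕ.<? b) tail? ⟩
  𝟙 (s ℕ.≤? x ×-dec x ℕ.<? b) * χ s (suc x) (n ∸ x) π                    ≡⟨ cong₂ _*_ (𝟙-× (s ℕ.≤? x) (x ℕ.<? b)) (sym (shift-≤ x (λ m → χ s (suc x) m π) n x≤n)) ⟩
  𝟙 (s ℕ.≤? x) * 𝟙 (x ℕ.<? b) * shift x (λ m → χ s (suc x) m π) n        ∎
  where
  open ≡-Reasoning
  tail? = Partition? (n ∸ x) π ×-dec Bounded? s (suc x) π
  below-head : ∀ {ρ} → Linked ℕ._≥_ (x ∷ ρ) → All (ℕ._< suc x) ρ
  below-head linked with Linked⇒AllPairs (λ p q → ℕₚ.≤-trans q p) linked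
  ... | below ∷ _ = All.map s≤s below
  cons : ∀ {ρ} → All (ℕ._< suc x) ρ → Linked ℕ._≥_ ρ → Linked ℕ._≥_ (x ∷ ρ)
  cons []             []     = [-]
  cons (s≤s y≤x ∷ _)  linked = y≤x ∷ linked
  to : ((Linked ℕ._≥_ (x ∷ π) × norm (x ∷ π) ≡ n) × (All (s ℕ.≤_) (x ∷ π) × All (ℕ._< b) (x ∷ π))) →
       (s ℕ.≤ x × x ℕ.< b) × ((Linked ℕ._≥_ π × norm π ≡ n ∸ x) × (All (s ℕ.≤_) π × All (ℕ._< suc x) π))
  to ((linked , eq) , (s≤x ∷ s≤ , x<b ∷ _)) =
    (s≤x , x<b) ,
    ((Linked.tail linked , trans (sym (ℕₚ.m+n∸m≡n x (norm π))) (cong (_∸ x) eq)) , (s≤ , below-head linked))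
  from : (s ℕ.≤ x × x ℕ.< b) × ((Linked ℕ._≥_ π × norm π ≡ n ∸ x) × (All (s ℕ.≤_) π × All (ℕ._< suc x) π)) →
         (Linked ℕ._≥_ (x ∷ π) × norm (x ∷ π) ≡ n) × (All (s ℕ.≤_) (x ∷ π) × All (ℕ._< b) (x ∷ π))
  from ((s≤x , x<b) , ((linked , eq) , (s≤ , below))) =
    (cons below linked , trans (cong (x ℕ.+_) eq) (ℕₚ.m+[n∸m]≡n x≤n)) ,
    (s≤x ∷ s≤ , x<b ∷ All.map (λ y≤x → ℕₚ.≤-trans y≤x x<b) below)

Σₗ-lists-suc : ∀ k N (f : List ℕ → ℤ) →
  Σₗ (lists (suc k) N) f ≡ ∑ N (λ i → Σₗ (lists k N) (λ π → f (suc i ∷ π)))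
Σₗ-lists-suc k N f = begin
  Σₗ (lists (suc k) N) f
    ≡⟨ Σₗ-concatMap (λ x → map (x ∷_) (lists k N)) (map suc (upTo N)) f ⟩
  Σₗ (map suc (upTo N)) (λ x → Σₗ (map (x ∷_) (lists k N)) f)
    ≡⟨ cong sumℤ (map-∘ (upTo N)) ⟨
  Σₗ (upTo N) (λ i → Σₗ (map (suc i ∷_) (lists k N)) f)
    ≡⟨ sum-applyUpTo (λ i → Σₗ (map (suc i ∷_) (lists k N)) f) id N ⟩
  ∑ N (λ i → Σₗ (map (suc i ∷_) (lists k N)) f)
    ≡⟨ ∑-cong N (λ i _ → cong sumℤ (sym (map-∘ (lists k N)))) ⟩
  ∑ N (λ i → Σₗ (lists k N) (λ π → f (suc i ∷ π)))
    ∎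
  where open ≡-Reasoning

-- The entries of `lists` are successors by construction. This supplies the positivity that
-- `partition-weight` assumes.
Σₗ-lists-cong : ∀ k N {f g : List ℕ → ℤ} → (∀ π → All (1 ℕ.≤_) π → f π ≡ g π) →
  Σₗ (lists k N) f ≡ Σₗ (lists k N) g
Σₗ-lists-cong zero    N         eq = cong (_+ 0ℤ) (eq [] [])
Σₗ-lists-cong (suc k) N {f} {g} eq = begin
  Σₗ (lists (suc k) N) f                              ≡⟨ Σₗ-lists-suc k N f ⟩
  ∑ N (λ i → Σₗ (lists k N) (λ π → f (suc i ∷ π)))    ≡⟨ ∑-cong N (λ i _ → Σₗ-lists-cong k N λ π pos → eq (suc i ∷ π) (s≤s z≤n ∷ pos)) ⟩
  ∑ N (λ i → Σₗ (lists k N) (λ π → g (suc i ∷ π)))    ≡⟨ Σₗ-lists-suc k N g ⟨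
  Σₗ (lists (suc k) N) g                              ∎
  where open ≡-Reasoning

-- For n ≤ N the cap `N` on the entries is no restriction, and this is the number of partitions of n
-- into exactly k parts from {s, ..., b - 1}.
count : ℕ → ℕ → ℕ → ℕ → PS
count N s b k n = Σₗ (lists k N) (χ s b n)

count-zero : ∀ N s b n → count N s b 0 n ≡ 1ₚ n
count-zero N s b zero    = refl
count-zero N s b (suc n) = refl

count-suc : ∀ N s b k n → count N s b (suc k) n ≡
  ∑ N (λ i → 𝟙 (s ℕ.≤? suc i) * 𝟙 (suc i ℕ.<? b) * shift (suc i) (count N s (suc (suc i)) k) n)
count-suc N s b k n = trans (Σₗ-lists-suc k N (χ s b n)) (∑-cong N term)
  where
  open ≡-Reasoning
  term : ∀ i → i ℕ.< N → Σₗ (lists k N) (λ π → χ s b n (suc i ∷ π)) ≡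
         𝟙 (s ℕ.≤? suc i) * 𝟙 (suc i ℕ.<? b) * shift (suc i) (count N s (suc (suc i)) k) n
  term i _ = begin
    Σₗ (lists k N) (λ π → χ s b n (suc i ∷ π))
      ≡⟨ Σₗ-cong (lists k N) (χ-∷ s b n (suc i)) ⟩
    Σₗ (lists k N) (λ π → w * shift (suc i) (λ m → χ s (suc (suc i)) m π) n)
      ≡⟨ Σₗ-*ˡ (lists k N) w (λ π → shift (suc i) (λ m → χ s (suc (suc i)) m π) n) ⟩
    w * Σₗ (lists k N) (λ π → shift (suc i) (λ m → χ s (suc (suc i)) m π) n)
      ≡⟨ cong (w *_) (Σₗ-shift (lists k N) (suc i) (χ s (suc (suc i))) n) ⟩
    w * shift (suc i) (count N s (suc (suc i)) k) n
      ∎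
    where w = 𝟙 (s ℕ.≤? suc i) * 𝟙 (suc i ℕ.<? b)

count-empty : ∀ N s k n → count N s s (suc k) n ≡ 0ℤ
count-empty N s k n = trans (count-suc N s s k n) (trans (∑-cong N vanish) (∑-zero N))
  where
  vanish : ∀ i → i ℕ.< N → 𝟙 (s ℕ.≤? suc i) * 𝟙 (suc i ℕ.<? s) * shift (suc i) (count N s (suc (suc i)) k) n ≡ 0ℤ
  vanish i _ = cong (_* shift (suc i) (count N s (suc (suc i)) k) n)
    (trans (sym (𝟙-× (s ℕ.≤? suc i) (suc i ℕ.<? s)))
           (𝟙-no (s ℕ.≤? suc i ×-dec suc i ℕ.<? s) λ (s≤ , <s) → ℕₚ.<⇒≱ <s s≤))

-- The summands are compared by their first part `suc i`: for i below or above `b` the two upper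
-- bounds agree, and i = b gives the extra term. If `b` lies outside the range, n ≤ N makes that
-- term vanish.
count-top : ∀ N s b k n → s ℕ.≤ suc b → n ℕ.≤ N →
  count N s (suc (suc b)) (suc k) n ≡
  count N s (suc b) (suc k) n + shift (suc b) (count N s (suc (suc b)) k) n
count-top N s b k n s≤b n≤N = begin
  count N s (suc (suc b)) (suc k) n
    ≡⟨ count-suc N s (suc (suc b)) k n ⟩
  ∑ N (λ i → u i * 𝟙 (suc i ℕ.<? suc (suc b)) * g i)
    ≡⟨ ∑-cong N (λ i _ → split i) ⟩
  ∑ N (λ i → u i * 𝟙 (suc i ℕ.<? suc b) * g i + 𝟙 (i ℕ.≟ b) * g i)
    ≡⟨ ∑-+ N (λ i → u i * 𝟙 (suc i ℕ.<? suc b) * g i) (λ i → 𝟙 (i ℕ.≟ b) * g i) ⟩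
  ∑ N (λ i → u i * 𝟙 (suc i ℕ.<? suc b) * g i) + ∑ N (λ i → 𝟙 (i ℕ.≟ b) * g i)
    ≡⟨ cong₂ _+_ (sym (count-suc N s (suc b) k n)) (∑-𝟙 N b g out) ⟩
  count N s (suc b) (suc k) n + g b
    ∎
  where
  open ≡-Reasoning
  u g : ℕ → ℤ
  u i = 𝟙 (s ℕ.≤? suc i)
  g i = shift (suc i) (count N s (suc (suc i)) k) n
  out : N ℕ.≤ b → g b ≡ 0ℤ
  out N≤b = shift-vanish (suc b) _ n (s≤s (ℕₚ.≤-trans n≤N N≤b))
  combine : ∀ i {x x′ y v : ℤ} → x ≡ x′ → v * x′ ≡ v * y + 𝟙 (i ℕ.≟ b) →
            v * x * g i ≡ v * y * g i + 𝟙 (i ℕ.≟ b) * g i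
  combine i {y = y} {v = v} refl eq = trans (cong (_* g i) eq) (ℤₚ.*-distribʳ-+ (g i) (v * y) (𝟙 (i ℕ.≟ b)))
  split : ∀ i → u i * 𝟙 (suc i ℕ.<? suc (suc b)) * g i ≡ u i * 𝟙 (suc i ℕ.<? suc b) * g i + 𝟙 (i ℕ.≟ b) * g i
  split i with ℕₚ.<-cmp i b
  ... | tri< i<b i≢b _ = combine i {v = u i}
    (trans (𝟙-yes (suc i ℕ.<? suc (suc b)) (s≤s (ℕₚ.m≤n⇒m≤1+n i<b))) (sym (𝟙-yes (suc i ℕ.<? suc b) (s≤s i<b))))
    (sym (trans (cong (u i * 𝟙 (suc i ℕ.<? suc b) +_) (𝟙-no (i ℕ.≟ b) i≢b)) (ℤₚ.+-identityʳ _)))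
  ... | tri> i≮b i≢b b<i = combine i {v = u i}
    (trans (𝟙-no (suc i ℕ.<? suc (suc b)) (λ { (s≤s (s≤s le)) → ℕₚ.<⇒≱ b<i le }))
      (sym (𝟙-no (suc i ℕ.<? suc b) λ { (s≤s lt) → i≮b lt })))
    (sym (trans (cong (u i * 𝟙 (suc i ℕ.<? suc b) +_) (𝟙-no (i ℕ.≟ b) i≢b)) (ℤₚ.+-identityʳ _)))
  ... | tri≈ i≮b refl _ = combine i {v = u i}
    (𝟙-yes (suc i ℕ.<? suc (suc i)) (s≤s (s≤s ℕₚ.≤-refl)))
    (begin
      u i * 1ℤ                                       ≡⟨ cong (_* 1ℤ) (𝟙-yes (s ℕ.≤? suc i) s≤b) ⟩
      1ℤ                                             ≡⟨ 𝟙-yes (i ℕ.≟ i) refl ⟨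
      𝟙 (i ℕ.≟ i)                                    ≡⟨ ℤₚ.+-identityˡ _ ⟨
      0ℤ + 𝟙 (i ℕ.≟ i)                               ≡⟨ cong (_+ 𝟙 (i ℕ.≟ i)) (ℤₚ.*-zeroʳ (u i)) ⟨
      u i * 0ℤ + 𝟙 (i ℕ.≟ i)                         ≡⟨ cong (λ z → u i * z + 𝟙 (i ℕ.≟ i)) (𝟙-no (suc i ℕ.<? suc i) (ℕₚ.<-irrefl refl)) ⟨
      u i * 𝟙 (suc i ℕ.<? suc i) + 𝟙 (i ℕ.≟ i)       ∎)

-- Lists of length at most K ≥ n suffice, since the parts are positive.
∑-count : ∀ N s j K n → n ℕ.≤ K → n ℕ.≤ N →
  ∑ (suc K) (λ k → count N (suc s) (suc s ℕ.+ j) k n) ≡ P (suc s) j n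
∑-count N s zero K n n≤K n≤N = begin
  ∑ (suc K) (λ k → count N (suc s) (suc s ℕ.+ 0) k n)      ≡⟨ cong (λ b → ∑ (suc K) (λ k → count N (suc s) b k n)) (ℕₚ.+-identityʳ (suc s)) ⟩
  ∑ (suc K) (λ k → count N (suc s) (suc s) k n)            ≡⟨ cong₂ _+_ (count-zero N (suc s) (suc s) n)
                                                                (trans (∑-cong K λ k _ → count-empty N (suc s) k n) (∑-zero K)) ⟩
  1ₚ n + 0ℤ                                                ≡⟨ ℤₚ.+-identityʳ (1ₚ n) ⟩
  1ₚ n                                                     ≡⟨ P-zero (suc s) n ⟨
  P (suc s) 0 n                                            ∎
  where open ≡-Reasoning
∑-count N s (suc j) zero    zero n≤K n≤N = refl
∑-count N s (suc j) (suc K) n n≤K n≤N = begin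
  ∑ (suc (suc K)) (λ k → count N (suc s) (suc s ℕ.+ suc j) k n)
    ≡⟨ cong (λ b → ∑ (suc (suc K)) (λ k → count N (suc s) b k n)) (ℕₚ.+-suc (suc s) j) ⟩
  count N (suc s) (suc t) 0 n + ∑ (suc K) (λ k → count N (suc s) (suc t) (suc k) n)
    ≡⟨ cong (count N (suc s) (suc t) 0 n +_) (trans (∑-cong (suc K) λ k _ → count-top N (suc s) (s ℕ.+ j) k n (ℕₚ.m≤m+n (suc s) j) n≤N)
         (∑-+ (suc K) (λ k → count N (suc s) t (suc k) n) (λ k → shift t (count N (suc s) (suc t) k) n))) ⟩
  count N (suc s) (suc t) 0 n + (S + ∑ (suc K) (λ k → shift t (count N (suc s) (suc t) k) n))
    ≡⟨ ℤₚ.+-assoc (count N (suc s) (suc t) 0 n) S _ ⟨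
  count N (suc s) (suc t) 0 n + S + ∑ (suc K) (λ k → shift t (count N (suc s) (suc t) k) n)
    -- The empty list meets every upper bound, so its count can be moved to the bound `t`, where it
    -- completes the sum over lengths.
    ≡⟨ cong₂ (λ x y → x + S + y) (trans (count-zero N (suc s) (suc t) n) (sym (count-zero N (suc s) t n)))
         (sym (shift-∑ t (suc K) (count N (suc s) (suc t)) n)) ⟩
  ∑ (suc (suc K)) (λ k → count N (suc s) t k n) + shift t (λ m → ∑ (suc K) (λ k → count N (suc s) (suc t) k m)) n
    -- This is the recurrence of `P-top`. The first sum has a smaller `j`; in the second the
    -- exponent has dropped by at least 1, so lengths up to `K` are enough.
    ≡⟨ cong₂ _+_ (∑-count N s j (suc K) n n≤K n≤N) (shift-rel _≡_ refl t n step) ⟩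
  P (suc s) j n + shift t (P (suc s) (suc j)) n
    ≡⟨ P-top s j n ⟨
  P (suc s) (suc j) n
    ∎
  where
  open ≡-Reasoning
  t = suc s ℕ.+ j
  S = ∑ (suc K) (λ k → count N (suc s) t (suc k) n)
  step : ∀ m → t ℕ.+ m ℕ.≤ n → ∑ (suc K) (λ k → count N (suc s) (suc t) k m) ≡ P (suc s) (suc j) m
  step m le = subst (λ b → ∑ (suc K) (λ k → count N (suc s) b k m) ≡ P (suc s) (suc j) m) (ℕₚ.+-suc (suc s) j)
    (∑-count N s (suc j) K m (ℕₚ.≤-pred (ℕₚ.≤-trans m<n n≤K)) (ℕₚ.≤-trans (ℕₚ.<⇒≤ m<n) n≤N))
    where m<n = shift-descent {s ℕ.+ j} le

-- Smallest and largest parts, and the left-hand side.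

smallest≤⇒All : ∀ x π {s} → s ℕ.≤ smallest (x ∷ π) → All (s ℕ.≤_) (x ∷ π)
smallest≤⇒All x []      s≤ = s≤ ∷ []
smallest≤⇒All x (y ∷ π) s≤ =
  ℕₚ.≤-trans s≤ (ℕₚ.m⊓n≤m x _) ∷ smallest≤⇒All y π (ℕₚ.≤-trans s≤ (ℕₚ.m⊓n≤n x (smallest (y ∷ π))))

-- Restricted to nonempty lists: on `[]` the premise is vacuous while `smallest` takes its default
-- value 0.
All⇒≤smallest : ∀ x π {s} → All (s ℕ.≤_) (x ∷ π) → s ℕ.≤ smallest (x ∷ π)
All⇒≤smallest x []      (s≤x ∷ _)  = s≤x
All⇒≤smallest x (y ∷ π) (s≤x ∷ s≤) = ℕₚ.⊓-glb s≤x (All⇒≤smallest y π s≤)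

largest≤⇒All : ∀ π {b} → largest π ℕ.≤ b → All (ℕ._< suc b) π
largest≤⇒All []      le = []
largest≤⇒All (x ∷ π) le =
  s≤s (ℕₚ.≤-trans (ℕₚ.m≤m⊔n x _) le) ∷ largest≤⇒All π (ℕₚ.≤-trans (ℕₚ.m≤n⊔m x (largest π)) le)

All⇒largest≤ : ∀ π {b} → All (ℕ._< suc b) π → largest π ℕ.≤ b
All⇒largest≤ []      []             = z≤n
All⇒largest≤ (x ∷ π) (s≤s x≤b ∷ le) = ℕₚ.⊔-lub x≤b (All⇒largest≤ π le)

smallest≤norm : ∀ π → smallest π ℕ.≤ norm π
smallest≤norm []          = z≤n
smallest≤norm (x ∷ [])    = ℕₚ.m≤m+n x 0
smallest≤norm (x ∷ y ∷ π) = ℕₚ.≤-trans (ℕₚ.m⊓n≤m x (smallest (y ∷ π))) (ℕₚ.m≤m+n x (norm (y ∷ π)))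

Admissible? : ∀ L π → Dec (0 ℕ.< norm π × largest π ∸ smallest π ℕ.≤ L)
Admissible? L π = ℕ._<?_ 0 (norm π) ×-dec ℕ._≤?_ (largest π ∸ smallest π) L

weight : ℕ → List ℕ → ℤ
weight L π = 𝟙 (Admissible? L π) * neg1^ (suc (smallest π))

-- The upper bound, parts at most (i + 1) + L, depends on `i` and not on `s`, so that two lower
-- bounds can be compared under the same upper bound.
bounds : ℕ → ℕ → ℕ → List ℕ → ℤ
bounds L i s π = 𝟙 (Bounded? s (suc i ℕ.+ suc L) π)

𝟙-≤-step : ∀ i t → 𝟙 (i ℕ.≤? t) - 𝟙 (suc i ℕ.≤? t) ≡ 𝟙 (i ℕ.≟ t)
𝟙-≤-step i t with ℕₚ.<-cmp i t
... | tri< i<t i≢t _ = trans (cong₂ _-_ (𝟙-yes (i ℕ.≤? t) (ℕₚ.<⇒≤ i<t)) (𝟙-yes (suc i ℕ.≤? t) i<t)) (sym (𝟙-no (i ℕ.≟ t) i≢t))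
... | tri≈ i≮t i≡t _ = trans (cong₂ _-_ (𝟙-yes (i ℕ.≤? t) (ℕₚ.≤-reflexive i≡t)) (𝟙-no (suc i ℕ.≤? t) i≮t)) (sym (𝟙-yes (i ℕ.≟ t) i≡t))
... | tri> i≮t i≢t t<i = trans (cong₂ _-_ (𝟙-no (i ℕ.≤? t) (ℕₚ.<⇒≱ t<i)) (𝟙-no (suc i ℕ.≤? t) i≮t)) (sym (𝟙-no (i ℕ.≟ t) i≢t))

-- Bounded below by s but not by s + 1 means that the smallest part is exactly s.
bounds-difference : ∀ L i x π t → smallest (x ∷ π) ≡ suc t →
  bounds L i (suc i) (x ∷ π) - bounds L i (suc (suc i)) (x ∷ π) ≡
  𝟙 (i ℕ.≟ t) * 𝟙 (all? (ℕ._<? suc i ℕ.+ suc L) (x ∷ π))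
bounds-difference L i x π t sm≡ = begin
  bounds L i (suc i) (x ∷ π) - bounds L i (suc (suc i)) (x ∷ π)
    ≡⟨ cong₂ _-_ (lower i) (lower (suc i)) ⟩
  𝟙 (i ℕ.≤? t) * u - 𝟙 (suc i ℕ.≤? t) * u
    ≡⟨ factor (𝟙 (i ℕ.≤? t)) (𝟙 (suc i ℕ.≤? t)) u ⟩
  (𝟙 (i ℕ.≤? t) - 𝟙 (suc i ℕ.≤? t)) * u
    ≡⟨ cong (_* u) (𝟙-≤-step i t) ⟩
  𝟙 (i ℕ.≟ t) * u
    ∎
  where
  open ≡-Reasoning
  u = 𝟙 (all? (ℕ._<? suc i ℕ.+ suc L) (x ∷ π))
  factor : ∀ a b c → a * c - b * c ≡ (a - b) * c
  factor = solve-∀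
  lower : ∀ s → bounds L i (suc s) (x ∷ π) ≡ 𝟙 (s ℕ.≤? t) * u
  lower s = trans (𝟙-× (all? (suc s ℕ.≤?_) (x ∷ π)) (all? (ℕ._<? suc i ℕ.+ suc L) (x ∷ π))) (cong (_* u)
    (𝟙-cong (all? (suc s ℕ.≤?_) (x ∷ π)) (s ℕ.≤? t)
      (λ s≤ → ℕₚ.≤-pred (subst (suc s ℕ.≤_) sm≡ (All⇒≤smallest x π s≤)))
      (λ s≤t → smallest≤⇒All x π (subst (suc s ℕ.≤_) (sym sm≡) (s≤s s≤t)))))

-- Only the index with `suc i` equal to the smallest part survives. It lies in the range because the
-- smallest part is at most the norm, and there the upper bound says that largest minus smallest is
-- at most L.
weight-∑-cons : ∀ L x π → All (1 ℕ.≤_) (x ∷ π) →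
  weight L (x ∷ π) ≡ ∑ (norm (x ∷ π)) (λ i → neg1^ (suc (suc i)) *
    (bounds L i (suc i) (x ∷ π) - bounds L i (suc (suc i)) (x ∷ π)))
weight-∑-cons L x π pos with smallest (x ∷ π) in sm≡ | All⇒≤smallest x π pos
-- Positive parts rule out a smallest part 0; `t` is its predecessor and thus the surviving index.
... | suc t | s≤s z≤n = sym (begin
  ∑ n (λ i → neg1^ (suc (suc i)) * (bounds L i (suc i) (x ∷ π) - bounds L i (suc (suc i)) (x ∷ π)))
    ≡⟨ ∑-cong n (λ i _ → trans (cong (neg1^ (suc (suc i)) *_) (bounds-difference L i x π t sm≡))
                               (exchange (neg1^ (suc (suc i))) (𝟙 (i ℕ.≟ t)) (u i))) ⟩
  ∑ n (λ i → 𝟙 (i ℕ.≟ t) * (u i * neg1^ (suc (suc i))))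
    ≡⟨ ∑-𝟙 n t (λ i → u i * neg1^ (suc (suc i))) (λ n≤t → contradiction n≤t (ℕₚ.<⇒≱ t<n)) ⟩
  u t * neg1^ (suc (suc t))
    ≡⟨ cong (_* neg1^ (suc (suc t))) (𝟙-cong (all? (ℕ._<? suc t ℕ.+ suc L) (x ∷ π)) (ℕ._<?_ 0 n ×-dec ℕ._≤?_ (largest (x ∷ π) ∸ suc t) L) to from) ⟩
  𝟙 (ℕ._<?_ 0 n ×-dec ℕ._≤?_ (largest (x ∷ π) ∸ suc t) L) * neg1^ (suc (suc t))
    ∎)
  where
  open ≡-Reasoning
  n = norm (x ∷ π)
  u : ℕ → ℤ
  u i = 𝟙 (all? (ℕ._<? suc i ℕ.+ suc L) (x ∷ π))
  exchange : ∀ a b c → a * (b * c) ≡ b * (c * a)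
  exchange = solve-∀
  t<n : t ℕ.< n
  t<n = subst (ℕ._≤ n) sm≡ (smallest≤norm (x ∷ π))
  to : All (ℕ._< suc t ℕ.+ suc L) (x ∷ π) → 0 ℕ.< n × largest (x ∷ π) ∸ suc t ℕ.≤ L
  to below = ℕₚ.≤-trans (s≤s z≤n) t<n ,
    ℕₚ.m≤n+o⇒m∸n≤o (largest (x ∷ π)) (suc t) (subst (largest (x ∷ π) ℕ.≤_) (ℕₚ.+-suc t L) (All⇒largest≤ (x ∷ π) below))
  from : 0 ℕ.< n × largest (x ∷ π) ∸ suc t ℕ.≤ L → All (ℕ._< suc t ℕ.+ suc L) (x ∷ π)
  from (_ , le) = largest≤⇒All (x ∷ π) (subst (largest (x ∷ π) ℕ.≤_) (sym (ℕₚ.+-suc t L))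
    (ℕₚ.≤-trans (ℕₚ.m≤n+m∸n (largest (x ∷ π)) (suc t)) (ℕₚ.+-monoʳ-≤ (suc t) le)))

weight-∑ : ∀ L π → All (1 ℕ.≤_) π → weight L π ≡
  ∑ (norm π) (λ i → neg1^ (suc (suc i)) * (bounds L i (suc i) π - bounds L i (suc (suc i)) π))
-- The empty list has norm 0: it is not admissible, and the sum is empty.
weight-∑ L []      pos = cong (_* neg1^ 1) (𝟙-no (Admissible? L []) λ ())
weight-∑ L (x ∷ π) pos = weight-∑-cons L x π pos

χ-difference : ℕ → ℕ → ℕ → List ℕ → ℤ
χ-difference L n i π = χ (suc i) (suc i ℕ.+ suc L) n π - χ (suc (suc i)) (suc i ℕ.+ suc L) n π

-- The partition indicator factors out of both `χ` terms. Where it is 1, the range `norm π` of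
-- `weight-∑` becomes `n`; where it is 0, both sides vanish.
partition-weight : ∀ L n π → All (1 ℕ.≤_) π →
  𝟙 (Partition? n π) * weight L π ≡ ∑ n (λ i → neg1^ (suc (suc i)) * χ-difference L n i π)
partition-weight L n π pos = trans (by-cases (Partition? n π)) (∑-cong n λ i _ → cong (neg1^ (suc (suc i)) *_)
  (sym (trans (cong₂ _-_ (𝟙-× (Partition? n π) (Bounded? (suc i) (suc i ℕ.+ suc L) π))
                         (𝟙-× (Partition? n π) (Bounded? (suc (suc i)) (suc i ℕ.+ suc L) π)))
              (factor (𝟙 (Partition? n π)) (bounds L i (suc i) π) (bounds L i (suc (suc i)) π)))))
  where
  factor : ∀ a b c → a * b - a * c ≡ a * (b - c)
  factor = solve-∀
  by-cases : (d : Dec (Linked ℕ._≥_ π × norm π ≡ n)) → 𝟙 d * weight L π ≡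
    ∑ n (λ i → neg1^ (suc (suc i)) * (𝟙 d * (bounds L i (suc i) π - bounds L i (suc (suc i)) π)))
  by-cases (yes (_ , refl)) = trans (ℤₚ.*-identityˡ (weight L π)) (trans (weight-∑ L π pos)
    (∑-cong n λ i _ → cong (neg1^ (suc (suc i)) *_) (sym (ℤₚ.*-identityˡ _))))
  by-cases (no _) = sym (trans (∑-cong n λ i _ → ℤₚ.*-zeroʳ (neg1^ (suc (suc i)))) (∑-zero n))

lhs-∑ : ∀ L n → lhs L n ≡ ∑ n (λ i → neg1^ (suc (suc i)) * R L (suc i) n)
lhs-∑ L n = begin
  lhs L n
    ≡⟨ Σₗ-filter (Admissible? L) (partitions n) (λ π → neg1^ (suc (smallest π))) ⟩
  Σₗ (partitions n) (weight L)
    ≡⟨ Σₗ-filter (Partition? n) candidates (weight L) ⟩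
  Σₗ candidates (λ π → 𝟙 (Partition? n π) * weight L π)
    ≡⟨ Σₗ-candidates (λ π → 𝟙 (Partition? n π) * weight L π) ⟩
  ∑ (suc n) (λ k → Σₗ (lists k n) (λ π → 𝟙 (Partition? n π) * weight L π))
    ≡⟨ ∑-cong (suc n) (λ k _ → Σₗ-lists-cong k n (partition-weight L n)) ⟩
  ∑ (suc n) (λ k → Σₗ (lists k n) (λ π → ∑ n (λ i → neg1^ (suc (suc i)) * χ-difference L n i π)))
    ≡⟨ Σₗ-candidates (λ π → ∑ n (λ i → neg1^ (suc (suc i)) * χ-difference L n i π)) ⟨
  Σₗ candidates (λ π → ∑ n (λ i → neg1^ (suc (suc i)) * χ-difference L n i π))
    ≡⟨ Σₗ-∑ candidates n (λ i π → neg1^ (suc (suc i)) * χ-difference L n i π) ⟩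
  ∑ n (λ i → Σₗ candidates (λ π → neg1^ (suc (suc i)) * χ-difference L n i π))
    ≡⟨ ∑-cong n (λ i _ → trans (Σₗ-*ˡ candidates (neg1^ (suc (suc i))) (χ-difference L n i))
                               (cong (neg1^ (suc (suc i)) *_) (exactly i))) ⟩
  ∑ n (λ i → neg1^ (suc (suc i)) * R L (suc i) n)
    ∎
  where
  open ≡-Reasoning
  candidates : List (List ℕ)
  candidates = concatMap (λ k → lists k n) (upTo (suc n))
  Σₗ-candidates : ∀ f → Σₗ candidates f ≡ ∑ (suc n) (λ k → Σₗ (lists k n) f)
  Σₗ-candidates f = trans (Σₗ-concatMap (λ k → lists k n) (upTo (suc n)) f)
    (sum-applyUpTo (λ k → Σₗ (lists k n) f) id (suc n))
  -- The bounds on length and on entries built into `partitions` are both n, which is just enough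
  -- for `∑-count`.
  number : ∀ s j → Σₗ candidates (χ (suc s) (suc s ℕ.+ j) n) ≡ P (suc s) j n
  number s j = trans (Σₗ-candidates (χ (suc s) (suc s ℕ.+ j) n)) (∑-count n s j n n ℕₚ.≤-refl ℕₚ.≤-refl)
  cancel : ∀ x y → x + y - x ≡ y
  cancel = solve-∀
  exactly : ∀ i → Σₗ candidates (χ-difference L n i) ≡ R L (suc i) n
  exactly i = begin
    Σₗ candidates (χ-difference L n i)
      ≡⟨ Σₗ-minus candidates (χ (suc i) (suc i ℕ.+ suc L) n) (χ (suc (suc i)) (suc i ℕ.+ suc L) n) ⟩
    Σₗ candidates (χ (suc i) (suc i ℕ.+ suc L) n) - Σₗ candidates (χ (suc (suc i)) (suc i ℕ.+ suc L) n)
      -- The interval from i + 1 to i + 1 + L has L + 1 elements; raising only its lower end leaves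
      -- L.
      ≡⟨ cong₂ _-_ (number i (suc L))
           (trans (cong (λ b → Σₗ candidates (χ (suc (suc i)) b n)) (ℕₚ.+-suc (suc i) L)) (number (suc i) L)) ⟩
    P (suc i) (suc L) n - P (suc (suc i)) L n
      ≡⟨ cong (λ z → z - P (suc (suc i)) L n) (P-bottom i L n) ⟩
    P (suc (suc i)) L n + R L (suc i) n - P (suc (suc i)) L n
      ≡⟨ cancel (P (suc (suc i)) L n) (R L (suc i) n) ⟩
    R L (suc i) n
      ∎

theorem1p3 : (L : ℕ) → L ≥ 1 →
    ((n : ℕ) → lhs L n ≡ rhs L n) × ((n : ℕ) → 0ℤ ≤ lhs L n)
theorem1p3 (suc l) _ =
  (λ n → trans (lhs-∑ (suc l) n) (sym (rhs-∑ (suc l) n))) ,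
  (λ n → subst (0ℤ ≤_) (sym (lhs-∑ (suc l) n)) (alternating-nonneg l n))
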